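{- There is no positive integer $n$ with $p^2(n,6)=36$; that is, no positive integer can be expressed as the sum of exactly $6$ positive squares in exactly $36$ ways.
   Context: $p^2(n,j)$ denotes the number of ways to write $n$ as a sum of exactly $j$ positive squares, up to order of summands. -}

module Defs where

open import Data.Nat using (ℕ; zero; suc; _+_; _*_; _≟_)
open import Data.List using (List; []; _∷_; length; map; concatMap; filter; upTo)
open import Data.Nat.ListAction using (sum)
open import Relation.Binary.PropositionalEquality using (_≡_)

-- nonIncr j m : all lists of length j of positive integers that are
-- non-increasing (weakly decreasing) and whose entries are all ≤ m.
-- Such lists are exactly the multisets of j positive integers bounded by m,
-- i.e. sums "up to order of summands".
nonIncr : ℕ → ℕ → List (List ℕ)
nonIncr zero    m = [] ∷ []
nonIncr (suc j) m =
  concatMap (λ i → map (λ xs → suc i ∷ xs) (nonIncr j (suc i))) (upTo m)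

sumSq : List ℕ → ℕ
sumSq xs = sum (map (λ x → x * x) xs)

-- p² n j : number of ways to write n as a sum of exactly j positive squares,
-- up to order of summands.  Every summand x satisfies x ≤ x * x ≤ n, so
-- bounding the entries by n loses nothing.
p² : ℕ → ℕ → ℕ
p² n j = length (filter (λ xs → sumSq xs ≟ n) (nonIncr j n))

{-# OPTIONS --safe #-}
-- By Lagrange's theorem n - 169 is a sum of four squares, and 169 is a sum of j positive squares for
-- every j from 1 to 5, so every n ≥ 169 is a sum of exactly five positive squares. For large n let
-- k run through the 37 integers ending at ⌊√(n - 700)⌋: then n - k² is a sum of five positive squares,
-- all at most k² since n ≤ 2k², and the resulting representations of n differ in their largest
-- part, so there are at least 37 of them. For medium n already k = ⌊√(n - 700)⌋ suffices: n - k² lies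
-- in [700, 1020], where every number is, by computation, a sum of five positive squares in at least
-- 37 ways. The remaining n < 1724 are computed.
module Submission where

open import Defs
open import Data.Nat using (ℕ; suc)
open import Relation.Binary.PropositionalEquality using (_≡_)
open import Relation.Nullary using (¬_)
open import Data.Empty using (⊥; ⊥-elim)
open import Data.Fin using (Fin; toℕ; fromℕ<; splitAt; join)
import Data.Fin.Properties as Fin
open import Data.List using (List; []; _∷_; _++_; [_]; map; filter; length; concatMap; upTo)
open import Data.List.Properties
open import Data.List.Membership.Propositional using (_∈_; lose)
open import Data.List.Membership.Propositional.Properties
open import Data.List.Relation.Unary.All as All using (All; []; _∷_)
import Data.List.Relation.Unary.All.Properties as All
open import Data.List.Relation.Unary.AllPairs using (AllPairs; []; _∷_)
open import Data.List.Relation.Unary.Any using (here)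
open import Data.List.Relation.Unary.Linked.Properties using (Linked⇒AllPairs)
open import Data.List.Relation.Binary.Permutation.Propositional using (_↭_; ↭-sym)
open import Data.List.Relation.Binary.Permutation.Propositional.Properties using (map⁺; All-resp-↭; ↭-length)
open import Data.Product using (_×_; _,_; proj₁; proj₂; ∃-syntax)
open import Data.Sum using (_⊎_; inj₁; inj₂)
open import Data.Unit using (tt)
open import Function using (_∘_; case_of_; flip)
open import Relation.Nullary using (Dec; yes; no)
open import Relation.Binary.PropositionalEquality hiding ([_])

-- Lagrange's four-square theorem.

module FourSquareTheorem where

  open import Data.Nat as ℕ using (ℕ; zero; suc; z≤n; s≤s; NonZero)
  import Data.Nat.Properties as ℕ
  import Data.Nat.Divisibility as ℕ
  open import Data.Nat.Divisibility using (divides) renaming (_∣_ to _∣ℕ_)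
  open import Data.Nat.Induction using (<-rec)
  open import Data.Nat.ListAction using (product)
  open import Data.Nat.Primality using (Prime; prime⇒irreducible; euclidsLemma; ¬prime[1])
  open import Data.Nat.Primality.Factorisation using (module PrimeFactorisation; factorise)
  import Data.Nat.Tactic.RingSolver as ℕ-Solver
  open import Data.Integer using (ℤ; _⊖_; +_; -[1+_]; _+_; _*_; _-_; -_; ∣_∣; 1ℤ; 0ℤ)
  open import Data.Integer.Properties
  open import Data.Integer.DivMod using (_%ℕ_; _/ℕ_; a≡a%ℕn+[a/ℕn]*n; n%ℕd<d)
  open import Data.Integer.Tactic.RingSolver using (solve-∀)

  norm : ℤ → ℤ → ℤ → ℤ → ℤ
  norm a b c d = a * a + b * b + c * c + d * d

  -- Stated over the integers because Euler's identity involves differences and the descent uses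
  -- residues of either sign.
  FourSquares : ℤ → Set
  FourSquares n = ∃[ a ] ∃[ b ] ∃[ c ] ∃[ d ] n ≡ norm a b c d

  -- Multiplicativity of the quaternion norm, applied to one quaternion times the conjugate of the
  -- other. The first coordinate is then the inner product, which is the form the descent relies on.
  euler : ∀ a b c d e f g h →
    (a * a + b * b + c * c + d * d) * (e * e + f * f + g * g + h * h) ≡
    (a * e + b * f + c * g + d * h) * (a * e + b * f + c * g + d * h)
    + (a * f - b * e + c * h - d * g) * (a * f - b * e + c * h - d * g)
    + (a * g - c * e + d * f - b * h) * (a * g - c * e + d * f - b * h)
    + (a * h - d * e + b * g - c * f) * (a * h - d * e + b * g - c * f)
  euler = solve-∀

  FourSquares-* : ∀ {m n} → FourSquares m → FourSquares n → FourSquares (m * n)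
  FourSquares-* (a , b , c , d , refl) (e , f , g , h , refl) =
    a * e + b * f + c * g + d * h , a * f - b * e + c * h - d * g ,
    a * g - c * e + d * f - b * h , a * h - d * e + b * g - c * f , euler a b c d e f g h

  -- Fermat descent on the multiples of a prime.

  -- The remainder of `x` serves if it is at most half of `m`; otherwise the remainder minus `m`
  -- does. The tie 2∣y∣ = m is possible and returns as a boundary case of the descent.
  balanced : ∀ x m .{{_ : NonZero m}} →
    ∃[ y ] ∃[ t ] x ≡ y + + m * t × 2 ℕ.* ∣ y ∣ ℕ.≤ m
  balanced x m with 2 ℕ.* (x %ℕ m) ℕ.≤? m
  ... | yes small = + (x %ℕ m) , x /ℕ m ,
    trans (a≡a%ℕn+[a/ℕn]*n x m) (cong (λ z → + (x %ℕ m) + z) (*-comm (x /ℕ m) (+ m))) , small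
  ... | no large = + ρ - + m , x /ℕ m + 1ℤ , trans (a≡a%ℕn+[a/ℕn]*n x m) (shift (+ ρ) (x /ℕ m) (+ m)) , bound
    where
    ρ = x %ℕ m
    shift : ∀ r q n → r + q * n ≡ r - n + n * (q + 1ℤ)
    shift = solve-∀
    ρ≤m = ℕ.<⇒≤ (n%ℕd<d x m)
    ∣y∣ : ∣ + ρ - + m ∣ ≡ m ℕ.∸ ρ
    ∣y∣ = trans (cong ∣_∣ (m-n≡m⊖n ρ m)) (∣⊖∣-≤ ρ≤m)
    bound : 2 ℕ.* ∣ + ρ - + m ∣ ℕ.≤ m
    bound = begin
      2 ℕ.* ∣ + ρ - + m ∣      ≡⟨ cong (2 ℕ.*_) ∣y∣ ⟩
      2 ℕ.* (m ℕ.∸ ρ)          ≡⟨ ℕ.*-distribˡ-∸ 2 m ρ ⟩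
      2 ℕ.* m ℕ.∸ 2 ℕ.* ρ      ≤⟨ ℕ.∸-monoʳ-≤ (2 ℕ.* m) (ℕ.≰⇒≥ large) ⟩
      2 ℕ.* m ℕ.∸ m            ≡⟨ cong (λ z → m ℕ.+ z ℕ.∸ m) (ℕ.+-identityʳ m) ⟩
      m ℕ.+ m ℕ.∸ m            ≡⟨ ℕ.m+n∸n≡m m m ⟩
      m ∎
      where open ℕ.≤-Reasoning

  ∣∣-square : ∀ i → + (∣ i ∣ ℕ.* ∣ i ∣) ≡ i * i
  ∣∣-square (+ n) = pos-* n n
  ∣∣-square -[1+ n ] = refl

  normℕ : ℕ → ℕ → ℕ → ℕ → ℕ
  normℕ a b c d = a ℕ.* a ℕ.+ b ℕ.* b ℕ.+ c ℕ.* c ℕ.+ d ℕ.* d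

  norm-abs : ∀ a b c d → + normℕ (∣ a ∣) (∣ b ∣) (∣ c ∣) (∣ d ∣) ≡ norm a b c d
  norm-abs a b c d rewrite sym (∣∣-square a) | sym (∣∣-square b) | sym (∣∣-square c) | sym (∣∣-square d) = refl

  -- The next multiplier of the descent first appears as an integer quotient; induction requires it
  -- as a natural number.
  quotient-natural : ∀ m .{{_ : NonZero m}} {y z} → + y ≡ + m * z → ∃[ r ] z ≡ + r × y ≡ m ℕ.* r
  quotient-natural m@(suc _) {z = + r} eq = r , refl , +-injective (trans eq (sym (pos-* m r)))
  quotient-natural (suc _) {z = -[1+ r ]} ()

  -- Writing x = y + m t coordinatewise and r = |y|²/m, the coordinates w of x·conj(y) are all
  -- divisible by m; they are given here after the division, so that no cancellation is needed.
  descend : ∀ m r p y₁ y₂ y₃ y₄ t₁ t₂ t₃ t₄ → norm y₁ y₂ y₃ y₄ ≡ m * r →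
    p ≡ r + (+ 2 * (t₁ * y₁ + t₂ * y₂ + t₃ * y₃ + t₄ * y₄) + m * (norm t₁ t₂ t₃ t₄)) →
    FourSquares (r * p)
  descend m r p y₁ y₂ y₃ y₄ t₁ t₂ t₃ t₄ eqr refl =
    r + T , w₂ , w₃ , w₄ , (begin
      r * (r + (+ 2 * T + m * S)) ≡⟨ expand r T m S ⟩
      r * r + + 2 * r * T + S * (m * r) ≡⟨ cong (λ z → r * r + + 2 * r * T + S * z) eqr ⟨
      r * r + + 2 * r * T + S * norm y₁ y₂ y₃ y₄
        ≡⟨ cong (λ z → r * r + + 2 * r * T + z) (euler t₁ t₂ t₃ t₄ y₁ y₂ y₃ y₄) ⟩
      r * r + + 2 * r * T + (T * T + w₂ * w₂ + w₃ * w₃ + w₄ * w₄)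
        ≡⟨ collect r T (w₂ * w₂) (w₃ * w₃) (w₄ * w₄) ⟩
      norm (r + T) w₂ w₃ w₄ ∎)
    where
    open ≡-Reasoning
    T = t₁ * y₁ + t₂ * y₂ + t₃ * y₃ + t₄ * y₄
    S = norm t₁ t₂ t₃ t₄
    w₂ = t₁ * y₂ - t₂ * y₁ + t₃ * y₄ - t₄ * y₃
    w₃ = t₁ * y₃ - t₃ * y₁ + t₄ * y₂ - t₂ * y₄
    w₄ = t₁ * y₄ - t₄ * y₁ + t₂ * y₃ - t₃ * y₂
    expand : ∀ r T m S → r * (r + (+ 2 * T + m * S)) ≡ r * r + + 2 * r * T + S * (m * r)
    expand = solve-∀
    collect : ∀ r T u v w → r * r + + 2 * r * T + (T * T + u + v + w) ≡ (r + T) * (r + T) + u + v + w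
    collect = solve-∀

  -- Expand |y + m t|² = |y|² + m (2⟨t, y⟩ + m |t|²): both the left side and the correction are
  -- multiples of `m`, hence so is |y|².
  residue-norm : ∀ m p y₁ y₂ y₃ y₄ t₁ t₂ t₃ t₄ →
    m * p ≡ norm (y₁ + m * t₁) (y₂ + m * t₂) (y₃ + m * t₃) (y₄ + m * t₄) →
    norm y₁ y₂ y₃ y₄ ≡ m * (p - (+ 2 * (t₁ * y₁ + t₂ * y₂ + t₃ * y₃ + t₄ * y₄) + m * (norm t₁ t₂ t₃ t₄)))
  residue-norm m p y₁ y₂ y₃ y₄ t₁ t₂ t₃ t₄ eq = sym (trans (distrib m p _)
    (trans (cong (_- m * (+ 2 * (t₁ * y₁ + t₂ * y₂ + t₃ * y₃ + t₄ * y₄) + m * (norm t₁ t₂ t₃ t₄))) eq)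
      (cancel m y₁ y₂ y₃ y₄ t₁ t₂ t₃ t₄)))
    where
    distrib : ∀ m p q → m * (p - q) ≡ m * p - m * q
    distrib = solve-∀
    cancel : ∀ m y₁ y₂ y₃ y₄ t₁ t₂ t₃ t₄ →
      (y₁ + m * t₁) * (y₁ + m * t₁) + (y₂ + m * t₂) * (y₂ + m * t₂) + (y₃ + m * t₃) * (y₃ + m * t₃) + (y₄ + m * t₄) * (y₄ + m * t₄)
      - m * (+ 2 * (t₁ * y₁ + t₂ * y₂ + t₃ * y₃ + t₄ * y₄) + m * (t₁ * t₁ + t₂ * t₂ + t₃ * t₃ + t₄ * t₄))
      ≡ y₁ * y₁ + y₂ * y₂ + y₃ * y₃ + y₄ * y₄
    cancel = solve-∀

  -- Applied to the numbers 2∣yᵢ∣. The strict alternative makes the multiplier decrease; the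
  -- equalities are the only case in which it might not.
  normℕ-bound : ∀ {a b c d m} → a ℕ.≤ m → b ℕ.≤ m → c ℕ.≤ m → d ℕ.≤ m →
    (a ≡ m × b ≡ m × c ≡ m × d ≡ m) ⊎ normℕ a b c d ℕ.< 4 ℕ.* (m ℕ.* m)
  normℕ-bound {a} {b} {c} {d} {m} a≤ b≤ c≤ d≤ = 
    case ℕ.m≤n⇒m<n∨m≡n a≤ , ℕ.m≤n⇒m<n∨m≡n b≤ , ℕ.m≤n⇒m<n∨m≡n c≤ , ℕ.m≤n⇒m<n∨m≡n d≤ of λ where
      (inj₂ e , inj₂ f , inj₂ g , inj₂ h) → inj₁ (e , f , g , h)
      (inj₁ l , _ , _ , _) → inj₂ (fit (ℕ.+-mono-<-≤ (ℕ.+-mono-<-≤ (ℕ.+-mono-<-≤ (lt l) (le b≤)) (le c≤)) (le d≤)))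
      (_ , inj₁ l , _ , _) → inj₂ (fit (ℕ.+-mono-<-≤ (ℕ.+-mono-<-≤ (ℕ.+-mono-≤-< (le a≤) (lt l)) (le c≤)) (le d≤)))
      (_ , _ , inj₁ l , _) → inj₂ (fit (ℕ.+-mono-<-≤ (ℕ.+-mono-≤-< (ℕ.+-mono-≤ (le a≤) (le b≤)) (lt l)) (le d≤)))
      (_ , _ , _ , inj₁ l) → inj₂ (fit (ℕ.+-mono-≤-< (ℕ.+-mono-≤ (ℕ.+-mono-≤ (le a≤) (le b≤)) (le c≤)) (lt l)))
    where
    le : ∀ {x} → x ℕ.≤ m → x ℕ.* x ℕ.≤ m ℕ.* m
    le x≤ = ℕ.*-mono-≤ x≤ x≤
    lt : ∀ {x} → x ℕ.< m → x ℕ.* x ℕ.< m ℕ.* m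
    lt x< = ℕ.*-mono-< x< x<
    four : ∀ s → s ℕ.+ s ℕ.+ s ℕ.+ s ≡ 4 ℕ.* s
    four s rewrite ℕ.+-identityʳ s | ℕ.+-assoc (s ℕ.+ s) s s | ℕ.+-assoc s s (s ℕ.+ s) = refl
    fit : ∀ {x} → x ℕ.< m ℕ.* m ℕ.+ m ℕ.* m ℕ.+ m ℕ.* m ℕ.+ m ℕ.* m → x ℕ.< 4 ℕ.* (m ℕ.* m)
    fit {x} = subst (x ℕ.<_) (four (m ℕ.* m))

  prime-divisor-bounds : ∀ {p m} → Prime p → 1 ℕ.< m → m ℕ.< p → ¬ m ∣ℕ p
  prime-divisor-bounds pr 1<m m<p m∣p with prime⇒irreducible pr m∣p
  ... | inj₁ refl = ℕ.<-irrefl refl 1<m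
  ... | inj₂ refl = ℕ.<-irrefl refl m<p

  ∣-abs : ∀ {m p : ℕ} (z : ℤ) → + p ≡ + m * z → m ∣ℕ p
  ∣-abs {m} z eq = divides ∣ z ∣ (trans (cong ∣_∣ eq) (trans (abs-* (+ m) z) (ℕ.*-comm m ∣ z ∣)))

  signed : ∀ y {m} → 2 ℕ.* ∣ y ∣ ≡ m → ∃[ s ] + 2 * y ≡ + m * s
  signed (+ n) refl = 1ℤ , trans (sym (pos-* 2 n)) (sym (*-identityʳ (+ (2 ℕ.* n))))
  signed -[1+ n ] refl = - 1ℤ , (begin
    + 2 * -[1+ n ]              ≡⟨ pull-sign (+ 2) (+ suc n) ⟩
    + 2 * + suc n * - 1ℤ        ≡⟨ cong (_* - 1ℤ) (pos-* 2 (suc n)) ⟨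
    + (2 ℕ.* suc n) * - 1ℤ ∎)
    where
    open ≡-Reasoning
    pull-sign : ∀ x y → x * - y ≡ x * y * - 1ℤ
    pull-sign = solve-∀

  -- In the boundary cases r = 0 and r = m of the descent, m divides r and every 2yᵢ, hence p.
  degenerate : ∀ (m ρ p y₁ y₂ y₃ y₄ t₁ t₂ t₃ t₄ s₁ s₂ s₃ s₄ : ℤ) →
    + 2 * y₁ ≡ m * s₁ → + 2 * y₂ ≡ m * s₂ → + 2 * y₃ ≡ m * s₃ → + 2 * y₄ ≡ m * s₄ →
    p ≡ m * ρ + (+ 2 * (t₁ * y₁ + t₂ * y₂ + t₃ * y₃ + t₄ * y₄) + m * (norm t₁ t₂ t₃ t₄)) →
    p ≡ m * (ρ + (t₁ * s₁ + t₂ * s₂ + t₃ * s₃ + t₄ * s₄ + norm t₁ t₂ t₃ t₄))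
  degenerate m ρ p y₁ y₂ y₃ y₄ t₁ t₂ t₃ t₄ s₁ s₂ s₃ s₄ e₁ e₂ e₃ e₄ refl = begin
    m * ρ + (+ 2 * (t₁ * y₁ + t₂ * y₂ + t₃ * y₃ + t₄ * y₄) + m * S)
      ≡⟨ push m ρ y₁ y₂ y₃ y₄ t₁ t₂ t₃ t₄ S ⟩
    m * ρ + (t₁ * (+ 2 * y₁) + t₂ * (+ 2 * y₂) + t₃ * (+ 2 * y₃) + t₄ * (+ 2 * y₄) + m * S)
      ≡⟨ cong₂ (λ u v → m * ρ + (t₁ * u + t₂ * v + t₃ * (+ 2 * y₃) + t₄ * (+ 2 * y₄) + m * S)) e₁ e₂ ⟩
    m * ρ + (t₁ * (m * s₁) + t₂ * (m * s₂) + t₃ * (+ 2 * y₃) + t₄ * (+ 2 * y₄) + m * S)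
      ≡⟨ cong₂ (λ u v → m * ρ + (t₁ * (m * s₁) + t₂ * (m * s₂) + t₃ * u + t₄ * v + m * S)) e₃ e₄ ⟩
    m * ρ + (t₁ * (m * s₁) + t₂ * (m * s₂) + t₃ * (m * s₃) + t₄ * (m * s₄) + m * S)
      ≡⟨ pull m ρ s₁ s₂ s₃ s₄ t₁ t₂ t₃ t₄ S ⟩
    m * (ρ + (t₁ * s₁ + t₂ * s₂ + t₃ * s₃ + t₄ * s₄ + S)) ∎
    where
    open ≡-Reasoning
    S = norm t₁ t₂ t₃ t₄
    push : ∀ m ρ y₁ y₂ y₃ y₄ t₁ t₂ t₃ t₄ S →
      m * ρ + (+ 2 * (t₁ * y₁ + t₂ * y₂ + t₃ * y₃ + t₄ * y₄) + m * S) ≡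
      m * ρ + (t₁ * (+ 2 * y₁) + t₂ * (+ 2 * y₂) + t₃ * (+ 2 * y₃) + t₄ * (+ 2 * y₄) + m * S)
    push = solve-∀
    pull : ∀ m ρ s₁ s₂ s₃ s₄ t₁ t₂ t₃ t₄ S →
      m * ρ + (t₁ * (m * s₁) + t₂ * (m * s₂) + t₃ * (m * s₃) + t₄ * (m * s₄) + m * S) ≡
      m * (ρ + (t₁ * s₁ + t₂ * s₂ + t₃ * s₃ + t₄ * s₄ + S))
    pull = solve-∀

  normℕ-zero : ∀ a b c d → normℕ a b c d ≡ 0 → a ≡ 0 × b ≡ 0 × c ≡ 0 × d ≡ 0
  normℕ-zero zero zero zero zero _ = refl , refl , refl , refl

  normℕ-double : ∀ a b c d → normℕ (2 ℕ.* a) (2 ℕ.* b) (2 ℕ.* c) (2 ℕ.* d) ≡ 4 ℕ.* normℕ a b c d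
  normℕ-double = double
    where
    double : ∀ a b c d →
      2 ℕ.* a ℕ.* (2 ℕ.* a) ℕ.+ 2 ℕ.* b ℕ.* (2 ℕ.* b) ℕ.+ 2 ℕ.* c ℕ.* (2 ℕ.* c) ℕ.+ 2 ℕ.* d ℕ.* (2 ℕ.* d) ≡
      4 ℕ.* (a ℕ.* a ℕ.+ b ℕ.* b ℕ.+ c ℕ.* c ℕ.+ d ℕ.* d)
    double = ℕ-Solver.solve-∀

  -- The bounds on the yᵢ alone give only 0 ≤ r ≤ m. If r = 0 then every yᵢ is 0, and if r = m then
  -- every 2∣yᵢ∣ is `m`; in both cases `m` would divide `p`, contrary to 1 < m < p.
  residue-bounds : ∀ {p m} → Prime p → .{{_ : NonZero m}} → 1 ℕ.< m → m ℕ.< p → ∀ r y₁ y₂ y₃ y₄ t₁ t₂ t₃ t₄ →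
    2 ℕ.* ∣ y₁ ∣ ℕ.≤ m → 2 ℕ.* ∣ y₂ ∣ ℕ.≤ m → 2 ℕ.* ∣ y₃ ∣ ℕ.≤ m → 2 ℕ.* ∣ y₄ ∣ ℕ.≤ m →
    normℕ (∣ y₁ ∣) (∣ y₂ ∣) (∣ y₃ ∣) (∣ y₄ ∣) ≡ m ℕ.* r →
    + p ≡ + r + (+ 2 * (t₁ * y₁ + t₂ * y₂ + t₃ * y₃ + t₄ * y₄) + + m * norm t₁ t₂ t₃ t₄) →
    0 ℕ.< r × r ℕ.< m
  residue-bounds {p} {m} pr 1<m m<p r y₁ y₂ y₃ y₄ t₁ t₂ t₃ t₄ b₁ b₂ b₃ b₄ Y≡mr p≡ =
    ℕ.n≢0⇒n>0 r≢0 , r<m (normℕ-bound b₁ b₂ b₃ b₄)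
    where
    open ≡-Reasoning
    m∤p = prime-divisor-bounds pr 1<m m<p
    4Y = normℕ-double (∣ y₁ ∣) (∣ y₂ ∣) (∣ y₃ ∣) (∣ y₄ ∣)
    refute : ∀ ρ s₁ s₂ s₃ s₄ → + r ≡ + m * ρ →
      + 2 * y₁ ≡ + m * s₁ → + 2 * y₂ ≡ + m * s₂ → + 2 * y₃ ≡ + m * s₃ → + 2 * y₄ ≡ + m * s₄ → ⊥
    refute ρ s₁ s₂ s₃ s₄ r≡ e₁ e₂ e₃ e₄ = m∤p (∣-abs {m} {p} (ρ + (t₁ * s₁ + t₂ * s₂ + t₃ * s₃ + t₄ * s₄ + norm t₁ t₂ t₃ t₄))
      (degenerate (+ m) ρ (+ p) y₁ y₂ y₃ y₄ t₁ t₂ t₃ t₄ s₁ s₂ s₃ s₄ e₁ e₂ e₃ e₄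
        (trans p≡ (cong (_+ (+ 2 * (t₁ * y₁ + t₂ * y₂ + t₃ * y₃ + t₄ * y₄) + + m * norm t₁ t₂ t₃ t₄)) r≡))))
    vanish : ∀ y → ∣ y ∣ ≡ 0 → + 2 * y ≡ + m * 0ℤ
    vanish y ∣y∣≡0 = trans (cong (+ 2 *_) (∣i∣≡0⇒i≡0 {y} ∣y∣≡0)) (sym (*-zeroʳ (+ m)))
    r≢0 : r ≢ 0
    r≢0 r≡0 =
      let z₁ , z₂ , z₃ , z₄ = normℕ-zero (∣ y₁ ∣) (∣ y₂ ∣) (∣ y₃ ∣) (∣ y₄ ∣)
                                (trans Y≡mr (trans (cong (m ℕ.*_) r≡0) (ℕ.*-zeroʳ m)))
      in refute 0ℤ 0ℤ 0ℤ 0ℤ 0ℤ (trans (cong +_ r≡0) (sym (*-zeroʳ (+ m))))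
           (vanish y₁ z₁) (vanish y₂ z₂) (vanish y₃ z₃) (vanish y₄ z₄)
    four : ∀ s → s ℕ.* s ℕ.+ s ℕ.* s ℕ.+ s ℕ.* s ℕ.+ s ℕ.* s ≡ 4 ℕ.* (s ℕ.* s)
    four = ℕ-Solver.solve-∀
    r<m : _ → r ℕ.< m
    r<m (inj₁ (e₁ , e₂ , e₃ , e₄)) = ⊥-elim (refute 1ℤ _ _ _ _ (trans (cong +_ r≡m) (sym (*-identityʳ (+ m))))
      (proj₂ (signed y₁ e₁)) (proj₂ (signed y₂ e₂)) (proj₂ (signed y₃ e₃)) (proj₂ (signed y₄ e₄)))
      where
      r≡m : r ≡ m
      r≡m = ℕ.*-cancelˡ-≡ r m m (ℕ.*-cancelˡ-≡ (m ℕ.* r) (m ℕ.* m) 4 (begin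
        4 ℕ.* (m ℕ.* r) ≡⟨ cong (4 ℕ.*_) Y≡mr ⟨
        4 ℕ.* normℕ (∣ y₁ ∣) (∣ y₂ ∣) (∣ y₃ ∣) (∣ y₄ ∣) ≡⟨ 4Y ⟨
        normℕ (2 ℕ.* ∣ y₁ ∣) (2 ℕ.* ∣ y₂ ∣) (2 ℕ.* ∣ y₃ ∣) (2 ℕ.* ∣ y₄ ∣)
          ≡⟨ cong₂ (λ u v → normℕ u v (2 ℕ.* ∣ y₃ ∣) (2 ℕ.* ∣ y₄ ∣)) e₁ e₂ ⟩
        normℕ m m (2 ℕ.* ∣ y₃ ∣) (2 ℕ.* ∣ y₄ ∣) ≡⟨ cong₂ (normℕ m m) e₃ e₄ ⟩
        normℕ m m m m ≡⟨ four m ⟩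
        4 ℕ.* (m ℕ.* m) ∎))
    r<m (inj₂ lt) = ℕ.*-cancelˡ-< m r m (ℕ.*-cancelˡ-< 4 (m ℕ.* r) (m ℕ.* m)
      (subst (ℕ._< 4 ℕ.* (m ℕ.* m)) (trans 4Y (cong (4 ℕ.*_) Y≡mr)) lt))

  reduce-multiple : ∀ {p m} → Prime p → .{{_ : NonZero m}} → 1 ℕ.< m → m ℕ.< p → ∀ y₁ y₂ y₃ y₄ t₁ t₂ t₃ t₄ →
    2 ℕ.* ∣ y₁ ∣ ℕ.≤ m → 2 ℕ.* ∣ y₂ ∣ ℕ.≤ m → 2 ℕ.* ∣ y₃ ∣ ℕ.≤ m → 2 ℕ.* ∣ y₄ ∣ ℕ.≤ m →
    + m * + p ≡ norm (y₁ + + m * t₁) (y₂ + + m * t₂) (y₃ + + m * t₃) (y₄ + + m * t₄) →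
    ∃[ r ] 0 ℕ.< r × r ℕ.< m × FourSquares (+ r * + p)
  reduce-multiple {p} {m} pr 1<m m<p y₁ y₂ y₃ y₄ t₁ t₂ t₃ t₄ b₁ b₂ b₃ b₄ eq =
    conclude (quotient-natural m
      (trans (norm-abs y₁ y₂ y₃ y₄) (residue-norm (+ m) (+ p) y₁ y₂ y₃ y₄ t₁ t₂ t₃ t₄ eq)))
    where
    -- By `residue-norm`, |y|² = m (p - E), so p - E is the next multiplier.
    E = + 2 * (t₁ * y₁ + t₂ * y₂ + t₃ * y₃ + t₄ * y₄) + + m * norm t₁ t₂ t₃ t₄
    add-back : ∀ p e → p ≡ p - e + e
    add-back = solve-∀
    conclude : ∃[ r ] + p - E ≡ + r × normℕ (∣ y₁ ∣) (∣ y₂ ∣) (∣ y₃ ∣) (∣ y₄ ∣) ≡ m ℕ.* r →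
      ∃[ r ] 0 ℕ.< r × r ℕ.< m × FourSquares (+ r * + p)
    conclude (r , r≡ , Y≡mr) = r , proj₁ bounds , proj₂ bounds ,
      descend (+ m) (+ r) (+ p) y₁ y₂ y₃ y₄ t₁ t₂ t₃ t₄
        (trans (sym (norm-abs y₁ y₂ y₃ y₄)) (trans (cong +_ Y≡mr) (pos-* m r))) p≡
      where
      p≡ : + p ≡ + r + E
      p≡ = trans (add-back (+ p) E) (cong (_+ E) r≡)
      bounds = residue-bounds pr 1<m m<p r y₁ y₂ y₃ y₄ t₁ t₂ t₃ t₄ b₁ b₂ b₃ b₄ Y≡mr p≡

  prime-descent-step : ∀ {p m} → Prime p → 1 ℕ.< m → m ℕ.< p → FourSquares (+ m * + p) →
    ∃[ r ] 0 ℕ.< r × r ℕ.< m × FourSquares (+ r * + p)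
  prime-descent-step {p} {m} pr 1<m m<p (x₁ , x₂ , x₃ , x₄ , eq) =
    reduce (balanced x₁ m) (balanced x₂ m) (balanced x₃ m) (balanced x₄ m)
    where
    instance
      m≢0 : NonZero m
      m≢0 = ℕ.>-nonZero (ℕ.<-trans (s≤s z≤n) 1<m)
    Balanced : ℤ → Set
    Balanced x = ∃[ y ] ∃[ t ] x ≡ y + + m * t × 2 ℕ.* ∣ y ∣ ℕ.≤ m
    reduce : Balanced x₁ → Balanced x₂ → Balanced x₃ → Balanced x₄ →
      ∃[ r ] 0 ℕ.< r × r ℕ.< m × FourSquares (+ r * + p)
    reduce (y₁ , t₁ , e₁ , b₁) (y₂ , t₂ , e₂ , b₂) (y₃ , t₃ , e₃ , b₃) (y₄ , t₄ , e₄ , b₄) =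
      reduce-multiple pr 1<m m<p y₁ y₂ y₃ y₄ t₁ t₂ t₃ t₄ b₁ b₂ b₃ b₄
        (trans eq (trans (cong₂ (λ u v → norm u v x₃ x₄) e₁ e₂)
                         (cong₂ (norm (y₁ + + m * t₁) (y₂ + + m * t₂)) e₃ e₄)))

  prime-descent : ∀ {p} → Prime p → ∀ m → 0 ℕ.< m → m ℕ.< p → FourSquares (+ m * + p) → FourSquares (+ p)
  prime-descent {p} pr = <-rec _ step
    where
    step : ∀ m → (∀ {r} → r ℕ.< m → 0 ℕ.< r → r ℕ.< p → FourSquares (+ r * + p) → FourSquares (+ p)) →
      0 ℕ.< m → m ℕ.< p → FourSquares (+ m * + p) → FourSquares (+ p)
    step m rec 0<m m<p sq with m ℕ.≟ 1
    ... | yes m≡1 = subst FourSquares (trans (cong (λ m → + m * + p) m≡1) (*-identityˡ (+ p))) sq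
    ... | no m≢1 =
      let r , 0<r , r<m , rp = prime-descent-step pr (ℕ.≤∧≢⇒< 0<m (m≢1 ∘ sym)) m<p sq
      in rec r<m 0<r (ℕ.<-trans r<m m<p) rp

  -- A small multiple of an odd prime that is a sum of four squares.

  %ℕ-≡⇒∣ : ∀ a b n .{{_ : NonZero n}} → a %ℕ n ≡ b %ℕ n → ∃[ k ] a - b ≡ k * + n
  %ℕ-≡⇒∣ a b n eq = a /ℕ n - b /ℕ n , (begin
    a - b
      ≡⟨ cong₂ _-_ (a≡a%ℕn+[a/ℕn]*n a n) (a≡a%ℕn+[a/ℕn]*n b n) ⟩
    (+ (a %ℕ n) + a /ℕ n * + n) - (+ (b %ℕ n) + b /ℕ n * + n)
      ≡⟨ cong (λ r → (+ (a %ℕ n) + a /ℕ n * + n) - (+ r + b /ℕ n * + n)) eq ⟨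
    (+ (a %ℕ n) + a /ℕ n * + n) - (+ (a %ℕ n) + b /ℕ n * + n)
      ≡⟨ cancel (+ (a %ℕ n)) (a /ℕ n) (b /ℕ n) (+ n) ⟩
    (a /ℕ n - b /ℕ n) * + n ∎)
    where
    open ≡-Reasoning
    cancel : ∀ r q s n → (r + q * n) - (r + s * n) ≡ (q - s) * n
    cancel = solve-∀

  ∣∧<⇒≡0 : ∀ {m n} → m ∣ℕ n → n ℕ.< m → n ≡ 0
  ∣∧<⇒≡0 {n = zero} _ _ = refl
  ∣∧<⇒≡0 {n = suc _} m∣n n<m = ⊥-elim (ℕ.<-irrefl refl (ℕ.<-≤-trans n<m (ℕ.∣⇒≤ m∣n)))

  -- The prime divides (i - j)(i + j), hence one of the factors. Both are smaller than `p` in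
  -- absolute value, so that factor is 0, and i + j = 0 forces i = j = 0.
  squares-distinct : ∀ {p h i j} → Prime p → h ℕ.+ h ℕ.< p → i ℕ.≤ h → j ℕ.≤ h →
    (∃[ k ] + i * + i - + j * + j ≡ k * + p) → i ≡ j
  squares-distinct {p} {h} {i} {j} pr 2h<p i≤h j≤h (k , eq) with euclidsLemma (∣ + i - + j ∣) (i ℕ.+ j) pr
    (divides ∣ k ∣ (begin
      ∣ + i - + j ∣ ℕ.* (i ℕ.+ j) ≡⟨ abs-* (+ i - + j) (+ i + + j) ⟨
      ∣ (+ i - + j) * (+ i + + j) ∣ ≡⟨ cong ∣_∣ (factor (+ i) (+ j)) ⟩
      ∣ + i * + i - + j * + j ∣ ≡⟨ cong ∣_∣ eq ⟩
      ∣ k * + p ∣ ≡⟨ abs-* k (+ p) ⟩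
      ∣ k ∣ ℕ.* p ∎))
    where
    open ≡-Reasoning
    factor : ∀ x y → (x - y) * (x + y) ≡ x * x - y * y
    factor = solve-∀
  ... | inj₁ p∣i-j = +-injective (i-j≡0⇒i≡j (+ i) (+ j) (∣i∣≡0⇒i≡0 (∣∧<⇒≡0 p∣i-j (begin-strict
      ∣ + i - + j ∣ ≡⟨ cong ∣_∣ (m-n≡m⊖n i j) ⟩
      ∣ i ⊖ j ∣ ≤⟨ ∣m⊝n∣≤m⊔n i j ⟩
      i ℕ.⊔ j ≤⟨ ℕ.⊔-lub i≤h j≤h ⟩
      h ≤⟨ ℕ.m≤m+n h h ⟩
      h ℕ.+ h <⟨ 2h<p ⟩
      p ∎))))
    where open ℕ.≤-Reasoning
  ... | inj₂ p∣i+j = trans (ℕ.m+n≡0⇒m≡0 i i+j≡0) (sym (ℕ.m+n≡0⇒n≡0 i i+j≡0))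
    where
    i+j≡0 = ∣∧<⇒≡0 p∣i+j (ℕ.≤-<-trans (ℕ.+-mono-≤ i≤h j≤h) 2h<p)

  -- The sum type records the kind of a collision: across the two summands it yields a multiple of
  -- `p` of the form 1 + x² + y², within one summand it contradicts `squares-distinct`.
  collisionResidue : ∀ {h} → Fin (suc h) ⊎ Fin (suc h) → ℤ
  collisionResidue (inj₁ x) = + toℕ x * + toℕ x
  collisionResidue (inj₂ y) = - (1ℤ + + toℕ y * + toℕ y)

  -- The residues x² and -(1 + y²) with 0 ≤ x, y ≤ h are 2h + 2 numbers modulo p = 2h + 1.
  prime-∣-1+x²+y² : ∀ h → Prime (suc (h ℕ.+ h)) →
    ∃[ x ] ∃[ y ] ∃[ k ] x ℕ.≤ h × y ℕ.≤ h × + x * + x - - (1ℤ + + y * + y) ≡ k * + suc (h ℕ.+ h)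
  prime-∣-1+x²+y² h pr with Fin.pigeonhole crowded (λ i → fromℕ< (n%ℕd<d (collisionResidue (splitAt (suc h) i)) p))
    where
    p = suc (h ℕ.+ h)
    crowded : p ℕ.< suc h ℕ.+ suc h
    crowded = s≤s (ℕ.≤-reflexive (sym (ℕ.+-suc h h)))
  ... | i , j , i<j , same = collide (splitAt (suc h) i) (splitAt (suc h) j) separate
      (%ℕ-≡⇒∣ (collisionResidue (splitAt (suc h) i)) (collisionResidue (splitAt (suc h) j)) p
        (Fin.fromℕ<-injective _ _ _ _ same))
    where
    p = suc (h ℕ.+ h)
    separate : splitAt (suc h) i ≢ splitAt (suc h) j
    separate eq = Fin.<⇒≢ i<j (trans (sym (Fin.join-splitAt (suc h) (suc h) i))
      (trans (cong (join (suc h) (suc h)) eq) (Fin.join-splitAt (suc h) (suc h) j)))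
    bound : (x : Fin (suc h)) → toℕ x ℕ.≤ h
    bound = Fin.toℕ≤pred[n]
    collide : ∀ s t → s ≢ t → (∃[ k ] collisionResidue s - collisionResidue t ≡ k * + p) →
      ∃[ x ] ∃[ y ] ∃[ k ] x ℕ.≤ h × y ℕ.≤ h × + x * + x - - (1ℤ + + y * + y) ≡ k * + p
    collide (inj₁ x) (inj₂ y) _ (k , eq) = toℕ x , toℕ y , k , bound x , bound y , eq
    collide (inj₂ y) (inj₁ x) _ (k , eq) = toℕ x , toℕ y , - k , bound x , bound y ,
      trans (anti-comm (+ toℕ x * + toℕ x) (- (1ℤ + + toℕ y * + toℕ y)))
        (trans (cong -_ eq) (neg-distribˡ-* k (+ p)))
      where
      anti-comm : ∀ u v → u - v ≡ - (v - u)
      anti-comm = solve-∀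
    collide (inj₁ x) (inj₁ y) x≢y multiple = ⊥-elim (x≢y (cong inj₁ (Fin.toℕ-injective
      (squares-distinct pr ℕ.≤-refl (bound x) (bound y) multiple))))
    collide (inj₂ x) (inj₂ y) x≢y (k , eq) = ⊥-elim (x≢y (cong inj₂ (Fin.toℕ-injective (sym
      (squares-distinct pr ℕ.≤-refl (bound y) (bound x) (k , trans (anti-comm (+ toℕ x * + toℕ x) (+ toℕ y * + toℕ y)) eq))))))
      where
      anti-comm : ∀ u v → v - u ≡ - (1ℤ + u) - - (1ℤ + v)
      anti-comm = solve-∀

  -- The multiple is x² + 1² + y² + 0² with x, y ≤ h. It is at least 1 and at most 2h² + 1 < p², so
  -- its cofactor lies strictly between 0 and `p`.
  prime-multiple : ∀ h → let p = suc (h ℕ.+ h) in Prime p →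
    ∃[ m ] 0 ℕ.< m × m ℕ.< p × FourSquares (+ m * + p)
  prime-multiple h pr with prime-∣-1+x²+y² h pr
  ... | x , y , k , x≤h , y≤h , eq = ∣ k ∣ , positive , small , + x , 1ℤ , + y , 0ℤ ,
      trans (sym (pos-* ∣ k ∣ p)) (trans (cong +_ (sym natural)) total)
    where
    p = suc (h ℕ.+ h)
    total : + (x ℕ.* x ℕ.+ 1 ℕ.+ y ℕ.* y ℕ.+ 0) ≡ norm (+ x) 1ℤ (+ y) 0ℤ
    total = norm-abs (+ x) 1ℤ (+ y) 0ℤ
    rearrange : ∀ u v → u + 1ℤ + v + 0ℤ ≡ u - - (1ℤ + v)
    rearrange = solve-∀
    natural : x ℕ.* x ℕ.+ 1 ℕ.+ y ℕ.* y ℕ.+ 0 ≡ ∣ k ∣ ℕ.* p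
    natural = trans (cong ∣_∣ (trans total (trans (rearrange (+ x * + x) (+ y * + y)) eq))) (abs-* k (+ p))
    positive : 0 ℕ.< ∣ k ∣
    positive = ℕ.n≢0⇒n>0 λ k≡0 → case trans natural (cong (ℕ._* p) k≡0) of λ z →
      ℕ.1+n≢0 (trans (onto (x ℕ.* x) (y ℕ.* y)) z)
      where
      onto : ∀ u v → suc (u ℕ.+ v) ≡ u ℕ.+ 1 ℕ.+ v ℕ.+ 0
      onto = ℕ-Solver.solve-∀
    -- The term 2h² + 4h is the exact gap between 2h² + 1 and (2h + 1)²; it is positive because h =
    -- 0 would make `p` equal to 1.
    square : ∀ h → (h ℕ.* h ℕ.+ 1 ℕ.+ h ℕ.* h ℕ.+ 0) ℕ.+ (2 ℕ.* (h ℕ.* h) ℕ.+ 4 ℕ.* h) ≡ suc (h ℕ.+ h) ℕ.* suc (h ℕ.+ h)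
    square = ℕ-Solver.solve-∀
    small : ∣ k ∣ ℕ.< p
    small = ℕ.*-cancelʳ-< p ∣ k ∣ p (begin-strict
      ∣ k ∣ ℕ.* p                          ≡⟨ natural ⟨
      x ℕ.* x ℕ.+ 1 ℕ.+ y ℕ.* y ℕ.+ 0    ≤⟨ ℕ.+-monoˡ-≤ 0 (ℕ.+-mono-≤ (ℕ.+-monoˡ-≤ 1 (ℕ.*-mono-≤ x≤h x≤h)) (ℕ.*-mono-≤ y≤h y≤h)) ⟩
      h ℕ.* h ℕ.+ 1 ℕ.+ h ℕ.* h ℕ.+ 0    <⟨ ℕ.m<m+n _ 0<h²+h ⟩
      (h ℕ.* h ℕ.+ 1 ℕ.+ h ℕ.* h ℕ.+ 0) ℕ.+ (2 ℕ.* (h ℕ.* h) ℕ.+ 4 ℕ.* h) ≡⟨ square h ⟩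
      p ℕ.* p                              ∎)
      where
      open ℕ.≤-Reasoning
      0<h : 0 ℕ.< h
      0<h = ℕ.n≢0⇒n>0 λ { refl → ¬prime[1] pr }
      0<h²+h : 0 ℕ.< 2 ℕ.* (h ℕ.* h) ℕ.+ 4 ℕ.* h
      0<h²+h = ℕ.<-≤-trans 0<h (ℕ.≤-trans (ℕ.m≤m+n h _) (ℕ.m≤n+m (4 ℕ.* h) (2 ℕ.* (h ℕ.* h))))

  -- From primes to all natural numbers.

  FourSquares-prime : ∀ {p} → Prime p → FourSquares (+ p)
  FourSquares-prime {p} pr with parity p
    where
    parity : ∀ n → ∃[ h ] (n ≡ h ℕ.+ h ⊎ n ≡ suc (h ℕ.+ h))
    parity zero = 0 , inj₁ refl
    parity (suc n) with parity n
    ... | h , inj₁ refl = h , inj₂ refl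
    ... | h , inj₂ refl = suc h , inj₁ (cong suc (sym (ℕ.+-suc h h)))
  ... | h , inj₂ refl = let m , 0<m , m<p , sq = prime-multiple h pr in prime-descent pr m 0<m m<p sq
  -- An even prime has the divisor 2, hence equals 2 = 1² + 1² + 0² + 0².
  ... | h , inj₁ refl with prime⇒irreducible pr (divides {2} h (trans (cong (h ℕ.+_) (sym (ℕ.+-identityʳ h))) (ℕ.*-comm 2 h)))
  ... | inj₂ 2≡p = subst (FourSquares ∘ +_) 2≡p (1ℤ , 1ℤ , 0ℤ , 0ℤ , refl)

  FourSquares-product : ∀ ps → All Prime ps → FourSquares (+ product ps)
  FourSquares-product [] [] = 1ℤ , 0ℤ , 0ℤ , 0ℤ , refl
  FourSquares-product (p ∷ ps) (pr ∷ prs) =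
    subst FourSquares (sym (pos-* p (product ps))) (FourSquares-* (FourSquares-prime pr) (FourSquares-product ps prs))

  lagrange : ∀ n → ∃[ a ] ∃[ b ] ∃[ c ] ∃[ d ] n ≡ normℕ a b c d
  lagrange zero = 0 , 0 , 0 , 0 , refl
  lagrange n@(suc _) = natural (subst (FourSquares ∘ +_) (sym (isFactorisation f)) (FourSquares-product (factors f) (factorsPrime f)))
    where
    open PrimeFactorisation
    f = factorise n
    natural : FourSquares (+ n) → ∃[ a ] ∃[ b ] ∃[ c ] ∃[ d ] n ≡ normℕ a b c d
    natural (a , b , c , d , eq) =
      ∣ a ∣ , ∣ b ∣ , ∣ c ∣ , ∣ d ∣ , +-injective (trans eq (sym (norm-abs a b c d)))

open FourSquareTheorem using (lagrange)
open import Data.Bool using (Bool; true; false; if_then_else_; T; not)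
open import Data.Bool.ListAction using (all)
open import Data.Nat
open import Data.Nat.Properties
open import Data.Nat.ListAction.Properties using (sum-↭)
open import Data.Nat.Tactic.RingSolver using (solve-∀)
import Relation.Binary.Construct.Flip.EqAndOrd as Flip
open import Data.List.Sort (Flip.decTotalOrder ≤-decTotalOrder) using (sort; sort-↭; sort-↗)

-- Counting representations by their largest part.

-- Separates the bound `m` on the parts from the target `n`, so that recursion on the bound is
-- possible; `p² n j` is `count j n n` by definition.
count : ℕ → ℕ → ℕ → ℕ
count j m n = length (filter (λ xs → sumSq xs ≟ n) (nonIncr j m))

nonIncr-suc : ∀ j m → nonIncr (suc j) (suc m) ≡ nonIncr (suc j) m ++ map (suc m ∷_) (nonIncr j (suc m))
nonIncr-suc j m = begin
  concatMap extend (upTo (suc m))            ≡⟨ cong (concatMap extend) (upTo-∷ʳ m) ⟨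
  concatMap extend (upTo m ++ [ m ])         ≡⟨ concatMap-++ extend (upTo m) [ m ] ⟩
  concatMap extend (upTo m) ++ (extend m ++ []) ≡⟨ cong (nonIncr (suc j) m ++_) (++-identityʳ (extend m)) ⟩
  concatMap extend (upTo m) ++ extend m      ∎
  where
  open ≡-Reasoning
  extend : ℕ → List (List ℕ)
  extend i = map (suc i ∷_) (nonIncr j (suc i))

count-cons : ∀ k r xss →
  length (filter (λ xs → sumSq xs ≟ k * k + r) (map (k ∷_) xss)) ≡ length (filter (λ xs → sumSq xs ≟ r) xss)
count-cons k r [] = refl
count-cons k r (xs ∷ xss) = by-cases (sumSq xs ≟ r)
  where
  P? = λ ys → sumSq ys ≟ k * k + r
  Q? = λ ys → sumSq ys ≟ r
  by-cases : Dec (sumSq xs ≡ r) →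
    length (filter P? (map (k ∷_) (xs ∷ xss))) ≡ length (filter Q? (xs ∷ xss))
  by-cases (yes eq) = begin
    length (filter P? (map (k ∷_) (xs ∷ xss))) ≡⟨ cong length (filter-accept P? {k ∷ xs} {map (k ∷_) xss} (cong (k * k +_) eq)) ⟩
    suc (length (filter P? (map (k ∷_) xss)))  ≡⟨ cong suc (count-cons k r xss) ⟩
    suc (length (filter Q? xss))               ≡⟨ cong length (filter-accept Q? {xs} {xss} eq) ⟨
    length (filter Q? (xs ∷ xss))              ∎
    where open ≡-Reasoning
  by-cases (no neq) = begin
    length (filter P? (map (k ∷_) (xs ∷ xss))) ≡⟨ cong length (filter-reject P? {k ∷ xs} {map (k ∷_) xss} (neq ∘ +-cancelˡ-≡ (k * k) (sumSq xs) r)) ⟩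
    length (filter P? (map (k ∷_) xss))        ≡⟨ count-cons k r xss ⟩
    length (filter Q? xss)                     ≡⟨ cong length (filter-reject Q? {xs} {xss} neq) ⟨
    length (filter Q? (xs ∷ xss))              ∎
    where open ≡-Reasoning

count-cons-none : ∀ k n xss → n < k * k → length (filter (λ xs → sumSq xs ≟ n) (map (k ∷_) xss)) ≡ 0
count-cons-none k n [] _ = refl
count-cons-none k n (xs ∷ xss) n<k² =
  trans (cong length (filter-reject (λ xs → sumSq xs ≟ n) {k ∷ xs} {map (k ∷_) xss}
    (λ eq → <-irrefl (sym eq) (<-≤-trans n<k² (m≤m+n (k * k) (sumSq xs))))))
  (count-cons-none k n xss n<k²)

count-split : ∀ j m n → count (suc j) (suc m) n ≡
  count (suc j) m n + length (filter (λ xs → sumSq xs ≟ n) (map (suc m ∷_) (nonIncr j (suc m))))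
count-split j m n = begin
  length (filter P? (nonIncr (suc j) (suc m))) ≡⟨ cong (length ∘ filter P?) (nonIncr-suc j m) ⟩
  length (filter P? (nonIncr (suc j) m ++ last)) ≡⟨ cong length (filter-++ P? (nonIncr (suc j) m) last) ⟩
  length (filter P? (nonIncr (suc j) m) ++ filter P? last) ≡⟨ length-++ (filter P? (nonIncr (suc j) m)) ⟩
  count (suc j) m n + length (filter P? last) ∎
  where
  open ≡-Reasoning
  P? = λ xs → sumSq xs ≟ n
  last = map (suc m ∷_) (nonIncr j (suc m))

-- The largest part is either at most `m` or equal to `suc m`. In the second case the other parts
-- may still equal `suc m`, so the bound stays.
count-suc-≥ : ∀ j m n → suc m * suc m ≤ n →
  count (suc j) (suc m) n ≡ count (suc j) m n + count j (suc m) (n ∸ suc m * suc m)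
count-suc-≥ j m n m²≤n = trans (count-split j m n) (cong (count (suc j) m n +_)
  (subst (λ z → length (filter (λ xs → sumSq xs ≟ z) (map (suc m ∷_) (nonIncr j (suc m)))) ≡ count j (suc m) (n ∸ suc m * suc m))
    (m+[n∸m]≡n m²≤n) (count-cons (suc m) (n ∸ suc m * suc m) (nonIncr j (suc m)))))

count-suc-< : ∀ j m n → n < suc m * suc m → count (suc j) (suc m) n ≡ count (suc j) m n
count-suc-< j m n n<m² = trans (count-split j m n) (trans
  (cong (count (suc j) m n +_) (count-cons-none (suc m) n (nonIncr j (suc m)) n<m²)) (+-identityʳ _))

-- Parts bounded by `m` cannot have squares summing to more than j m². In the recurrence both
-- summands are again oversized.
count-oversized : ∀ j m n → j * (m * m) < n → count j m n ≡ 0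
count-oversized zero m (suc n) _ = refl
count-oversized (suc j) zero n _ = refl
count-oversized (suc j) (suc m) n big = trans (count-suc-≥ j m n sq≤n) (cong₂ _+_
  (count-oversized (suc j) m n (≤-<-trans (*-monoʳ-≤ (suc j) (*-mono-≤ (n≤1+n m) (n≤1+n m))) big))
  (count-oversized j (suc m) (n ∸ sq) (+-cancelˡ-< sq _ _ (subst (sq + j * sq <_) (sym (m+[n∸m]≡n sq≤n)) big))))
  where
  sq = suc m * suc m
  sq≤n : sq ≤ n
  sq≤n = ≤-trans (m≤m+n sq (j * sq)) (<⇒≤ big)

-- Counting up to a threshold.

-- missing j m n t = t ∸ count j m n, computed by a search that stops as soon as t solutions
-- have been found and discards branches in which j squares ≤ m² cannot reach n.
missing : ℕ → ℕ → ℕ → ℕ → ℕ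
missing _       _       _       zero    = zero
missing zero    _       zero    (suc t) = t
missing zero    _       (suc _) (suc t) = suc t
missing (suc j) zero    _       (suc t) = suc t
missing (suc j) (suc m) n       (suc t) =
  if suc j * (suc m * suc m) <ᵇ n then suc t
  else if suc m * suc m ≤ᵇ n then missing (suc j) m n (missing j (suc m) (n ∸ suc m * suc m) (suc t))
  else missing (suc j) m n (suc t)

-- What the branch with largest part `suc m` leaves to be found is handed on as the target of the
-- other branch. Iterated truncated subtraction subtracts the sum, so the two counts add up as in
-- the recurrence.
missing-count : ∀ j m n t → missing j m n t ≡ t ∸ count j m n
missing-count j       m       n       zero    = sym (0∸n≡0 (count j m n))
missing-count zero    m       zero    (suc t) = refl
missing-count zero    m       (suc n) (suc t) = refl
missing-count (suc j) zero    n       (suc t) = refl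
missing-count (suc j) (suc m) n       (suc t)
  with suc j * (suc m * suc m) <ᵇ n in oversized
... | true = cong (suc t ∸_) (sym (count-oversized (suc j) (suc m) n (<ᵇ⇒< _ _ (subst T (sym oversized) tt))))
... | false with suc m * suc m ≤ᵇ n in fits
...   | true = begin
  missing (suc j) m n (missing j (suc m) (n ∸ sq) (suc t)) ≡⟨ missing-count (suc j) m n _ ⟩
  missing j (suc m) (n ∸ sq) (suc t) ∸ count (suc j) m n
    ≡⟨ cong (_∸ count (suc j) m n) (missing-count j (suc m) (n ∸ sq) (suc t)) ⟩
  suc t ∸ count j (suc m) (n ∸ sq) ∸ count (suc j) m n ≡⟨ ∸-+-assoc (suc t) (count j (suc m) (n ∸ sq)) _ ⟩
  suc t ∸ (count j (suc m) (n ∸ sq) + count (suc j) m n) ≡⟨ cong (suc t ∸_) (+-comm (count j (suc m) (n ∸ sq)) _) ⟩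
  suc t ∸ (count (suc j) m n + count j (suc m) (n ∸ sq))
    ≡⟨ cong (suc t ∸_) (count-suc-≥ j m n (≤ᵇ⇒≤ sq n (subst T (sym fits) tt))) ⟨
  suc t ∸ count (suc j) (suc m) n ∎
  where
  open ≡-Reasoning
  sq = suc m * suc m
...   | false = trans (missing-count (suc j) m n (suc t))
  (cong (suc t ∸_) (sym (count-suc-< j m n (≰⇒> λ le → subst T fits (≤⇒≤ᵇ le)))))

-- From unordered representations to positive counts.

count-mono : ∀ j {m m′} n → m ≤′ m′ → count j m n ≤ count j m′ n
count-mono zero n _ = ≤-refl
count-mono (suc j) n ≤′-refl = ≤-refl
count-mono (suc j) {m′ = suc m′} n (≤′-step le) = ≤-trans (count-mono (suc j) n le)
  (≤-trans (m≤m+n _ _) (≤-reflexive (sym (count-split j m′ n))))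

∈-nonIncr : ∀ {m xs} → AllPairs _≥_ xs → All (λ x → 0 < x × x ≤ m) xs → xs ∈ nonIncr (length xs) m
∈-nonIncr [] [] = here refl
∈-nonIncr {m} {suc x ∷ xs} (x≥xs ∷ pairs) ((_ , x<m) ∷ bounds) =
  ∈-concatMap⁺ (λ i → map (suc i ∷_) (nonIncr (length xs) (suc i))) {xs = upTo m} (lose (∈-upTo⁺ x<m)
    (∈-map⁺ (suc x ∷_) (∈-nonIncr pairs (All.zipWith (λ { ((0<y , _) , y≤x) → 0<y , y≤x }) (bounds , x≥xs)))))

∈⇒0<length : ∀ {A : Set} {x : A} {xs} → x ∈ xs → 0 < length xs
∈⇒0<length {xs = _ ∷ _} _ = z<s

sumSq-bound : ∀ xs k → sumSq xs ≤ k * k → All (_≤ k) xs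
sumSq-bound [] k _ = []
sumSq-bound (x ∷ xs) k le =
  ≮⇒≥ (λ k<x → <⇒≱ (*-mono-< k<x k<x) (≤-trans (m≤m+n (x * x) (sumSq xs)) le)) ∷
  sumSq-bound xs k (≤-trans (m≤n+m (sumSq xs) (x * x)) le)

sumSq-↭ : ∀ {xs ys} → xs ↭ ys → sumSq xs ≡ sumSq ys
sumSq-↭ p = sum-↭ (map⁺ _ p)

-- Sorting in descending order brings the list into the form enumerated by `nonIncr`, with the same
-- length and sum of squares. No part exceeds `k`, since its square alone would exceed k².
count-positive : ∀ xs k → All (0 <_) xs → sumSq xs ≤ k * k → 0 < count (length xs) k (sumSq xs)
count-positive xs k 0<xs le = subst₂ (λ j n → 0 < count j k n) (↭-length p) (sumSq-↭ p)
  (∈⇒0<length (∈-filter⁺ (λ ys → sumSq ys ≟ sumSq (sort xs)) (∈-nonIncr descending bounds) refl))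
  where
  p = sort-↭ xs
  descending : AllPairs _≥_ (sort xs)
  descending = Linked⇒AllPairs (flip ≤-trans) (sort-↗ xs)
  bounds : All (λ x → 0 < x × x ≤ k) (sort xs)
  bounds = All-resp-↭ (↭-sym p) (All.zip (0<xs , sumSq-bound xs k le))

-- Sums of exactly five positive squares.

sumSq-++ : ∀ xs ys → sumSq (xs ++ ys) ≡ sumSq xs + sumSq ys
sumSq-++ [] ys = refl
sumSq-++ (x ∷ xs) ys = trans (cong (x * x +_) (sumSq-++ xs ys)) (sym (+-assoc (x * x) (sumSq xs) (sumSq ys)))

sumSq-positives : ∀ xs → sumSq (filter (0 <?_) xs) ≡ sumSq xs
sumSq-positives [] = refl
sumSq-positives (zero ∷ xs) = sumSq-positives xs
sumSq-positives (suc x ∷ xs) = cong (suc x * suc x +_) (sumSq-positives xs)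

-- 169 is a sum of j positive squares for every j from 1 to 5.
padding : ∀ j → j ≤ 4 → ∃[ xs ] length xs ≡ 5 ∸ j × All (0 <_) xs × sumSq xs ≡ 169
padding 0 _ = 12 ∷ 4 ∷ 2 ∷ 2 ∷ 1 ∷ [] , refl , z<s ∷ z<s ∷ z<s ∷ z<s ∷ z<s ∷ [] , refl
padding 1 _ = 10 ∷ 8 ∷ 2 ∷ 1 ∷ [] , refl , z<s ∷ z<s ∷ z<s ∷ z<s ∷ [] , refl
padding 2 _ = 12 ∷ 4 ∷ 3 ∷ [] , refl , z<s ∷ z<s ∷ z<s ∷ [] , refl
padding 3 _ = 12 ∷ 5 ∷ [] , refl , z<s ∷ z<s ∷ [] , refl
padding 4 _ = 13 ∷ [] , refl , z<s ∷ [] , refl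
padding (suc (suc (suc (suc (suc _))))) (s≤s (s≤s (s≤s (s≤s ()))))

-- Dropping the zeros from Lagrange's four squares for `n` leaves at most four positive ones; a
-- decomposition of 169 into the right number of squares fills up to five.
five-positive-squares : ∀ n → ∃[ xs ] length xs ≡ 5 × All (0 <_) xs × sumSq xs ≡ 169 + n
five-positive-squares n with lagrange n
... | a , b , c , d , refl = combine (padding (length xs) (length-filter (0 <?_) squares))
  where
  squares = a ∷ b ∷ c ∷ d ∷ []
  xs = filter (0 <?_) squares
  reassociate : ∀ a b c d → a + (b + (c + (d + 0))) ≡ a + b + c + d
  reassociate = solve-∀
  combine : (∃[ ys ] length ys ≡ 5 ∸ length xs × All (0 <_) ys × sumSq ys ≡ 169) → _
  combine (ys , len , 0<ys , sumys) = ys ++ xs ,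
    trans (length-++ ys) (trans (cong (_+ length xs) len) (m∸n+n≡m (≤-trans (length-filter (0 <?_) squares) (n≤1+n 4)))) ,
    All.++⁺ 0<ys (All.all-filter (0 <?_) squares) ,
    trans (sumSq-++ ys xs) (cong₂ _+_ sumys
      (trans (sumSq-positives squares) (reassociate (a * a) (b * b) (c * c) (d * d))))

count₅-positive : ∀ k n → 169 ≤ n → n ≤ k * k → 0 < count 5 k n
count₅-positive k n 169≤n n≤k² with five-positive-squares (n ∸ 169)
... | xs , len , 0<xs , sumxs = subst₂ (λ j n → 0 < count j k n) len total
    (count-positive xs k 0<xs (subst (_≤ k * k) (sym total) n≤k²))
  where
  total : sumSq xs ≡ n
  total = trans sumxs (m+[n∸m]≡n 169≤n)

-- Tools for the lower bounds.

-- Each admissible `k` from u + 1 to u + d contributes a representation with largest part `k`, and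
-- the recurrence counts different largest parts separately.
largest-part-range : ∀ n u d → (∀ i → i < d → let k = suc (u + i) in k * k ≤ n × 0 < count 5 k (n ∸ k * k)) →
  d ≤ count 6 (u + d) n
largest-part-range n u zero _ = z≤n
largest-part-range n u (suc d) good rewrite +-suc u d = begin
  suc d                             ≡⟨ +-comm 1 d ⟩
  d + 1                             ≤⟨ +-mono-≤ (largest-part-range n u d (λ i i<d → good i (m<n⇒m<1+n i<d))) (proj₂ (good d ≤-refl)) ⟩
  count 6 (u + d) n + count 5 (suc (u + d)) (n ∸ suc (u + d) * suc (u + d))
    ≡⟨ count-suc-≥ 5 (u + d) n (proj₁ (good d ≤-refl)) ⟨
  count 6 (suc (u + d)) n ∎
  where open ≤-Reasoning

-- The explicit remainder, at most 2s, fixes the length of the window in which n - s² has to be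
-- examined.
floor-sqrt : ∀ n → ∃[ s ] ∃[ e ] n ≡ s * s + e × e ≤ s + s
floor-sqrt zero = 0 , 0 , refl , z≤n
floor-sqrt (suc n) with floor-sqrt n
... | s , e , n≡ , e≤2s with m≤n⇒m<n∨m≡n e≤2s
...   | inj₁ e<2s = s , suc e , trans (cong suc n≡) (sym (+-suc (s * s) e)) , e<2s
...   | inj₂ refl = suc s , 0 , trans (cong suc n≡) (next s) , z≤n
  where
  next : ∀ s → suc (s * s + (s + s)) ≡ suc s * suc s + 0
  next = solve-∀

-- Finite computations.

-- Turns one Boolean evaluation, certified by `refl`, into a statement about every `n` below `N`.
all-upTo : ∀ N (p : ℕ → Bool) → all p (upTo N) ≡ true → ∀ {n} → n < N → T (p n)
all-upTo N p eq n<N = All.lookup (All.all⁺ p (upTo N) (subst T (sym eq) tt)) (∈-upTo⁺ n<N)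

-- With threshold 37 the search result is 1 exactly when the count is 36, and no search goes on
-- after 37 solutions.
count₆-small : ∀ {n} → n < 1724 → count 6 n n ≢ 36
count₆-small {n} n<1724 eq = check (missing 6 n n 37) (trans (missing-count 6 n n 37) (cong (37 ∸_) eq))
  (all-upTo 1724 (λ n → not (missing 6 n n 37 ≡ᵇ 1)) refl n<1724)
  where
  check : ∀ x → x ≡ 1 → T (not (x ≡ᵇ 1)) → ⊥
  check _ refl ()

-- Here 320 = 2 · 160 is the largest remainder for s ≤ 160. The bound 32 excludes no representation
-- because 32² > 1020, and it is the least `s` for which the window is used.
count₅-window : ∀ {e} → e ≤ 320 → 37 ≤ count 5 32 (700 + e)
count₅-window {e} e≤320 = m∸n≡0⇒m≤n (trans (sym (missing-count 5 32 (700 + e) 37))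
  (≡ᵇ⇒≡ _ 0 (all-upTo 321 (λ e → missing 5 32 (700 + e) 37 ≡ᵇ 0) refl (s≤s e≤320))))

-- Medium and large numbers.

residual : ∀ {n k e} → n ≡ 700 + (k * k + e) → n ∸ k * k ≡ 700 + e
residual {k = k} {e} refl = trans (cong (_∸ k * k) (rearrange (k * k) e)) (m+n∸m≡n (k * k) (700 + e))
  where
  rearrange : ∀ q e → 700 + (q + e) ≡ q + (700 + e)
  rearrange q e = trans (sym (+-assoc 700 q e)) (trans (cong (_+ e) (+-comm 700 q)) (+-assoc q 700 e))

count₆-middle : ∀ {n s e} → n ≡ 700 + (s * s + e) → e ≤ s + s → 32 ≤ s → s ≤ 160 → 37 ≤ count 6 s n
count₆-middle {n} {s@(suc s′)} {e} n≡ e≤2s 32≤s s≤160 = begin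
  37                                         ≤⟨ count₅-window (≤-trans e≤2s (+-mono-≤ s≤160 s≤160)) ⟩
  count 5 32 (700 + e)                       ≤⟨ count-mono 5 (700 + e) (≤⇒≤′ 32≤s) ⟩
  count 5 s (700 + e)                        ≡⟨ cong (count 5 s) (residual {k = s} n≡) ⟨
  -- Only the representations with largest part exactly `s` are kept.
  count 5 s (n ∸ s * s)                      ≤⟨ m≤n+m _ (count 6 s′ n) ⟩
  count 6 s′ n + count 5 s (n ∸ s * s)       ≡⟨ count-suc-≥ 5 s′ n s²≤n ⟨
  count 6 s n ∎
  where
  open ≤-Reasoning
  s²≤n : s * s ≤ n
  s²≤n = ≤-trans (m≤m+n (s * s) e) (≤-trans (m≤n+m _ 700) (≤-reflexive (sym n≡)))

-- Writing s = v + 161 avoids subtraction: the 37 largest parts run from v + 125 to v + 161. For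
-- each such `k`, k ≤ s gives n - k² ≥ 169, and k ≥ v + 125 gives n - k² ≤ k², as `count₅-positive`
-- demands.
count₆-asymptotic : ∀ {n e} v → let s = v + 161 in n ≡ 700 + (s * s + e) → e ≤ s + s → 37 ≤ count 6 s n
count₆-asymptotic {n} {e} v n≡ e≤2s = subst (λ s → 37 ≤ count 6 s n) (+-assoc v 124 37)
  (largest-part-range n (v + 124) 37 good)
  where
  s = v + 161
  -- The polynomial v² + 176v + 4307 is the slack between the largest possible `n`, namely 700 + s²
  -- + 2s, and 2k² for the smallest `k`.
  expand : ∀ v → 700 + ((v + 161) * (v + 161) + (v + 161 + (v + 161))) + (v * v + 176 * v + 4307) ≡
    (v + 125) * (v + 125) + (v + 125) * (v + 125)
  expand = solve-∀
  n≤2k² : n ≤ (v + 125) * (v + 125) + (v + 125) * (v + 125)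
  n≤2k² = begin
    n                          ≡⟨ n≡ ⟩
    700 + (s * s + e)          ≤⟨ +-monoʳ-≤ 700 (+-monoʳ-≤ (s * s) e≤2s) ⟩
    700 + (s * s + (s + s))    ≤⟨ m≤m+n _ (v * v + 176 * v + 4307) ⟩
    700 + (s * s + (s + s)) + (v * v + 176 * v + 4307) ≡⟨ expand v ⟩
    (v + 125) * (v + 125) + (v + 125) * (v + 125) ∎
    where open ≤-Reasoning
  s²+169≤n : s * s + 169 ≤ n
  s²+169≤n = begin
    s * s + 169       ≡⟨ +-comm (s * s) 169 ⟩
    169 + s * s       ≤⟨ +-mono-≤ (m≤m+n 169 531) (m≤m+n (s * s) e) ⟩
    700 + (s * s + e) ≡⟨ n≡ ⟨
    n ∎
    where open ≤-Reasoning
  good : ∀ i → i < 37 → let k = suc (v + 124 + i) in k * k ≤ n × 0 < count 5 k (n ∸ k * k)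
  good i i<37 = ≤-trans (m≤m+n (k * k) 169) k²+169≤n ,
    count₅-positive k (n ∸ k * k)
      (subst (_≤ n ∸ k * k) (m+n∸m≡n (k * k) 169) (∸-monoˡ-≤ (k * k) k²+169≤n))
      (subst (n ∸ k * k ≤_) (m+n∸n≡m (k * k) (k * k)) (∸-monoˡ-≤ (k * k) n≤k²+k²))
    where
    k = suc (v + 124 + i)
    k≤s : k ≤ s
    k≤s = begin
      suc (v + 124 + i) ≡⟨ +-suc (v + 124) i ⟨
      v + 124 + suc i   ≤⟨ +-monoʳ-≤ (v + 124) i<37 ⟩
      v + 124 + 37      ≡⟨ +-assoc v 124 37 ⟩
      v + 161 ∎
      where open ≤-Reasoning
    k≥ : v + 125 ≤ k
    k≥ = ≤-trans (≤-reflexive (+-suc v 124)) (s≤s (m≤m+n (v + 124) i))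
    k²+169≤n : k * k + 169 ≤ n
    k²+169≤n = ≤-trans (+-monoˡ-≤ 169 (*-mono-≤ k≤s k≤s)) s²+169≤n
    n≤k²+k² : n ≤ k * k + k * k
    n≤k²+k² = ≤-trans n≤2k² (+-mono-≤ (*-mono-≤ k≥ k≥) (*-mono-≤ k≥ k≥))

count₆-large : ∀ {n} → 1724 ≤ n → 37 ≤ count 6 n n
count₆-large {n} 1724≤n with floor-sqrt (n ∸ 700)
... | s , e , n∸700≡ , e≤2s = ≤-trans (bound (s ≤? 160)) (count-mono 6 n (≤⇒≤′ s≤n))
  where
  n≡ : n ≡ 700 + (s * s + e)
  n≡ = trans (sym (m+[n∸m]≡n (≤-trans (m≤m+n 700 1024) 1724≤n))) (cong (700 +_) n∸700≡)
  square-≥ : ∀ s → s ≤ s * s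
  square-≥ zero = z≤n
  square-≥ s@(suc _) = m≤m*n s s
  s≤n : s ≤ n
  s≤n = ≤-trans (square-≥ s) (≤-trans (m≤m+n (s * s) e) (≤-trans (m≤n+m _ 700) (≤-reflexive (sym n≡))))
  -- The threshold is 1724 = 700 + 32²: for s ≤ 31, `n` is at most 700 + 31² + 62 = 1723.
  32≤s : 32 ≤ s
  32≤s = ≮⇒≥ λ { (s≤s s≤31) → <⇒≱ 1724≤n (begin
    n                         ≡⟨ n≡ ⟩
    700 + (s * s + e)         ≤⟨ +-monoʳ-≤ 700 (+-mono-≤ (*-mono-≤ s≤31 s≤31) (≤-trans e≤2s (+-mono-≤ s≤31 s≤31))) ⟩
    1723 ∎) }
    where open ≤-Reasoning
  bound : Dec (s ≤ 160) → 37 ≤ count 6 s n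
  bound (yes s≤160) = count₆-middle n≡ e≤2s 32≤s s≤160
  bound (no s≰160) = subst (λ s → 37 ≤ count 6 s n) s≡ (count₆-asymptotic (s ∸ 161)
    (subst (λ s → n ≡ 700 + (s * s + e)) (sym s≡) n≡) (subst (λ s → e ≤ s + s) (sym s≡) e≤2s))
    where
    s≡ : s ∸ 161 + 161 ≡ s
    s≡ = m∸n+n≡m (≰⇒> s≰160)

theorem6p4 : (n : ℕ) → ¬ (p² (suc n) 6 ≡ 36)
theorem6p4 n eq with suc n <? 1724
... | yes small = count₆-small small eq
-- The bound 37 ≤ `p² (suc n) 6` is by definition the strict inequality with 36.
... | no large = <-irrefl (sym eq) (count₆-large (≮⇒≥ large))
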